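{- Let $G$ be a finite chordal graph and let $r\geq 1$ be an integer with $r\leq \mu(G)/2$. Then for any cross-intersecting pair $(\mathcal{A},\mathcal{B})$ in $\mathcal{J}^r(G)$, we have $|\mathcal{A}|+|\mathcal{B}|\leq |\mathcal{J}^r(G)|$.
   Context: A graph is chordal if it has no induced cycle on more than $3$ vertices. For a graph $G$, $\mu(G)$ denotes the minimum size of a maximal (with respect to inclusion) independent set in $G$, and $\mathcal{J}^r(G)$ denotes the family of all independent vertex sets of size $r$ in $G$. A pair $(\mathcal{A},\mathcal{B})$ is a cross-intersecting pair in $\mathcal{J}^r(G)$ if $\mathcal{A},\mathcal{B}\subseteq\mathcal{J}^r(G)$ and $A\cap B\neq\emptyset$ for every $A\in\mathcal{A}$, $B\in\mathcal{B}$. -}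

module Defs where

open import Data.Nat using (ℕ; zero; suc; _≤_; _*_; _⊓_; _%_)
open import Data.Bool using (Bool; true; false; _∧_; not)
open import Data.Fin using (Fin; toℕ)
open import Data.Fin.Subset using (Subset; _∈_; _∉_; ∣_∣; _∪_; ⁅_⁆; Nonempty; _∩_; inside; outside)
open import Data.Vec using (Vec; []; _∷_; lookup)
open import Data.List using (List; []; _∷_; map; _++_; filterᵇ; foldr; length)

open import Data.List.Membership.Propositional using () renaming (_∈_ to _∈ₗ_)
open import Data.List.Relation.Unary.Unique.Propositional using (Unique)
open import Data.List.Relation.Unary.All using (All)
open import Data.Product using (_×_; Σ)
open import Relation.Binary.PropositionalEquality using (_≡_)
open import Relation.Nullary using (¬_)
open import Function.Definitions using (Injective)
open import Function.Bundles using (_⇔_)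

record Graph (n : ℕ) : Set where
  field
    adj   : Fin n → Fin n → Bool
    sym   : ∀ i j → adj i j ≡ adj j i
    irrefl : ∀ i → adj i i ≡ false
open Graph public

allFin : (n : ℕ) → List (Fin n)
allFin zero = []
allFin (suc n) = Fin.zero ∷ map Fin.suc (allFin n)

allSubsets : (n : ℕ) → List (Subset n)
allSubsets zero = [] ∷ []
allSubsets (suc n) = map (outside ∷_) (allSubsets n) ++ map (inside ∷_) (allSubsets n)

allᵇ : ∀ {A : Set} → (A → Bool) → List A → Bool
allᵇ p [] = true
allᵇ p (x ∷ xs) = p x ∧ allᵇ p xs

memᵇ : ∀ {n} → Fin n → Subset n → Bool
memᵇ i S = lookup S i

Independent : ∀ {n} → Graph n → Subset n → Set
Independent G S = ∀ i j → i ∈ S → j ∈ S → adj G i j ≡ false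

MaximalIndependent : ∀ {n} → Graph n → Subset n → Set
MaximalIndependent G S = Independent G S × (∀ v → v ∉ S → ¬ Independent G (S ∪ ⁅ v ⁆))

independentᵇ : ∀ {n} → Graph n → Subset n → Bool
independentᵇ {n} G S =
  allᵇ (λ i → allᵇ (λ j → not (memᵇ i S ∧ memᵇ j S ∧ adj G i j)) (allFin n)) (allFin n)

maximalIndependentᵇ : ∀ {n} → Graph n → Subset n → Bool
maximalIndependentᵇ {n} G S =
  independentᵇ G S ∧ allᵇ (λ v → memᵇ v S ∨' not (independentᵇ G (S ∪ ⁅ v ⁆))) (allFin n)
  where
  _∨'_ : Bool → Bool → Bool
  true ∨' _ = true
  false ∨' b = b

-- μ(G): minimum size of a maximal independent set (the list is never empty,
-- every graph has a maximal independent set; n is an upper bound for sizes).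
μ : ∀ {n} → Graph n → ℕ
μ {n} G = foldr (λ S m → ∣ S ∣ ⊓ m) n (filterᵇ (maximalIndependentᵇ G) (allSubsets n))

InJ : ∀ {n} → Graph n → ℕ → Subset n → Set
InJ G r S = Independent G S × ∣ S ∣ ≡ r

sizeIsᵇ : ∀ {n} → ℕ → Subset n → Bool
sizeIsᵇ r S = eqᵇ ∣ S ∣ r
  where
  eqᵇ : ℕ → ℕ → Bool
  eqᵇ zero zero = true
  eqᵇ (suc a) (suc b) = eqᵇ a b
  eqᵇ _ _ = false

J : ∀ {n} → Graph n → ℕ → List (Subset n)
J {n} G r = filterᵇ (λ S → independentᵇ G S ∧ sizeIsᵇ r S) (allSubsets n)

Consecutive : (k : ℕ) → Fin k → Fin k → Set
Consecutive zero () _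
Consecutive (suc k) i j = (suc (toℕ i) % suc k ≡ toℕ j) ⊎' (suc (toℕ j) % suc k ≡ toℕ i)
  where
  open import Data.Sum using () renaming (_⊎_ to _⊎'_)

InducedCycle : ∀ {n} → Graph n → ℕ → Set
InducedCycle {n} G k =
  Σ (Fin k → Fin n) λ c → Injective _≡_ _≡_ c × (∀ i j → (adj G (c i) (c j) ≡ true) ⇔ Consecutive k i j)

Chordal : ∀ {n} → Graph n → Set
Chordal G = ∀ k → 4 ≤ k → ¬ InducedCycle G k

-- cross-intersecting pair of families in J^r(G), families given as duplicate-free lists
CrossIntersecting : ∀ {n} → Graph n → ℕ → List (Subset n) → List (Subset n) → Set
CrossIntersecting G r 𝒜 ℬ =
  All (InJ G r) 𝒜 × All (InJ G r) ℬ × (∀ A B → A ∈ₗ 𝒜 → B ∈ₗ ℬ → Nonempty (A ∩ B))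

{-# OPTIONS --safe #-}
module Submission where

open import Defs
open import Algebra.Properties.CommutativeSemigroup using (interchange)
open import Data.Bool using (Bool; true; false; _∧_; _∨_; not; if_then_else_)
import Data.Bool.Properties as Bool
open import Data.Empty using (⊥)
open import Data.Fin using (Fin; zero; suc; toℕ)
import Data.Fin.Properties as Fin
open import Data.Fin.Subset using (Subset; _∈_; _∉_; _⊆_; ∣_∣; ⊤; ∁; ⁅_⁆; _∪_; _∩_; Nonempty; inside; outside)
open import Data.Fin.Subset.Properties
open import Data.List using (List; []; _∷_; map; _++_; filterᵇ; foldr; length)
open import Data.List.Membership.DecPropositional using () renaming (_∈?_ to ∈ₗ-dec)
open import Data.List.Membership.Propositional using () renaming (_∈_ to _∈ₗ_)
open import Data.List.Membership.Propositional.Properties using (∈-map⁺; ∈-++⁺ˡ; ∈-++⁺ʳ)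
open import Data.List.Properties using (filter-++; length-++)
open import Data.List.Relation.Unary.All using (All) renaming (lookup to All-lookup)
open import Data.List.Relation.Unary.AllPairs using ([]; _∷_)
open import Data.List.Relation.Unary.Any using (here; there)
open import Data.List.Relation.Unary.Unique.Propositional using (Unique)
open import Data.Nat using (ℕ; zero; suc; _≤_; _<_; _*_; _+_; _∸_; _⊓_; _%_; z≤n; s≤s; NonZero; >-nonZero)
open import Data.Nat.Combinatorics using (_C_; nCk≡nC[n∸k]; nCn≡1; k>n⇒nCk≡0; nCk+nC[k+1]≡[n+1]C[k+1])
open import Data.Nat.DivMod using (m<n⇒m%n≡m; n%n≡0)
open import Data.Nat.Properties
open import Data.Product using (Σ; _×_; _,_; proj₁; proj₂; ∃; ∃₂)
open import Data.Sum using (_⊎_; inj₁; inj₂; [_,_]′)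
import Data.Sum as Sum
open import Data.Vec using (here; there; []; _∷_; lookup; updateAt; tabulate)
open import Data.Vec.Properties using
  (≡-dec; ∷-injectiveʳ; lookup∘tabulate; lookup∘updateAt; lookup∘updateAt′; []=⇒lookup; lookup⇒[]=;
   updateAt-updateAt; updateAt-id-local)
open import Function using (_∘_; _⇔_; mk⇔; Equivalence)
open import Relation.Binary.Definitions using (tri<; tri≈; tri>)
open import Relation.Binary.PropositionalEquality
  using (_≡_; _≢_; refl; trans; cong; cong₂; subst; module ≡-Reasoning) renaming (sym to ≡-sym)
open import Relation.Nullary using (¬_; Dec; yes; no; does; contradiction; ¬?; _×-dec_; _⊎-dec_; _→-dec_)
import Relation.Nullary.Decidable as Dec
open import Relation.Nullary.Decidable using (dec-true; dec-false; does-⇔)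

-- The proof is by induction on the number of vertices of an induced subgraph G[W].  If G[W] has an
-- edge, it has adjacent u, v with N[v] ⊆ N[u]: otherwise one could walk forever, always leaving the
-- closed neighbourhood of the last but one vertex, and the first chord or return of such a walk
-- would close an induced cycle of length at least 4.  Replacing u by v wherever this yields a new
-- member changes neither the sizes of the families nor the cross-intersection property, and
-- afterwards two members containing u also meet outside u.  So the members avoiding u are
-- cross-intersecting in G[W - u], and the links of u are cross-intersecting (r-1)-sets in
-- G[W \ N[u]]; the minimum size of a maximal independent set does not drop in the first graph and
-- drops by at most one in the second.  If G[W] has no edge, the disjointness graph on the r-subsets
-- of W is regular, and double counting its edges gives the bound.

private variable n : ℕ

-- Dominated edges of chordal graphs

true≢false : ∀ {b} → b ≡ true → b ≡ false → ⊥
true≢false refl ()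

-- `Consecutive (suc D)` read on natural numbers, with `D` the last index of the cycle, so that
-- positions can be compared by `<`.
CycleAdjacent : (D a b : ℕ) → Set
CycleAdjacent D a b = (suc a % suc D ≡ b) ⊎ (suc b % suc D ≡ a)

suc% : ∀ {D a} → a < D → suc a % suc D ≡ suc a
suc% a<D = m<n⇒m%n≡m (s≤s a<D)

-- For indices up to `D` the remainder wraps around only at `D`, so apart from successive indices
-- only the pair 0, `D` is joined.
cycleAdjacent-< : ∀ {D a b} → a < b → b ≤ D →
  CycleAdjacent D a b ⇔ (b ≡ suc a ⊎ (a ≡ 0 × b ≡ D))
cycleAdjacent-< {D} {a} {b} a<b b≤D = mk⇔ to from
  where
  to : CycleAdjacent D a b → b ≡ suc a ⊎ (a ≡ 0 × b ≡ D)
  to (inj₁ e) = inj₁ (trans (≡-sym e) (suc% (<-≤-trans a<b b≤D)))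
  to (inj₂ e) with m≤n⇒m<n∨m≡n b≤D
  ... | inj₁ b<D = contradiction (subst (b <_) (trans (≡-sym (suc% b<D)) e) ≤-refl) (<-asym a<b)
  ... | inj₂ refl = inj₂ (trans (≡-sym e) (n%n≡0 (suc b)) , refl)
  from : b ≡ suc a ⊎ (a ≡ 0 × b ≡ D) → CycleAdjacent D a b
  from (inj₁ refl) = inj₁ (suc% b≤D)
  from (inj₂ (refl , refl)) = inj₂ (n%n≡0 (suc b))

cycleAdjacent-irrefl : ∀ {D a} → 2 ≤ D → a ≤ D → suc a % suc D ≢ a
cycleAdjacent-irrefl {D} {a} 2≤D a≤D e with m≤n⇒m<n∨m≡n a≤D
... | inj₁ a<D = 1+n≢n (trans (≡-sym (suc% a<D)) e)
... | inj₂ refl = contradiction (subst (2 ≤_) (trans (≡-sym e) (n%n≡0 (suc a))) 2≤D) λ ()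

-- Adjacency and cyclic succession are both symmetric and both fail on the diagonal, so the pairs in
-- increasing order decide everything.
cycle-of : (G : Graph n) (p : ℕ → Fin n) (D : ℕ) → 2 ≤ D →
  (∀ {a b} → a < b → b ≤ D → p a ≢ p b × (adj G (p a) (p b) ≡ true ⇔ (b ≡ suc a ⊎ (a ≡ 0 × b ≡ D)))) →
  InducedCycle G (suc D)
cycle-of G p D 2≤D pair = p ∘ toℕ , (λ {i} {j} → inj i j) , adjacency
  where
  inj : ∀ i j → p (toℕ i) ≡ p (toℕ j) → i ≡ j
  inj i j e with <-cmp (toℕ i) (toℕ j)
  ... | tri< i<j _ _ = contradiction e (proj₁ (pair i<j (Fin.toℕ≤pred[n] j)))
  ... | tri≈ _ i≡j _ = Fin.toℕ-injective i≡j
  ... | tri> _ _ j<i = contradiction (≡-sym e) (proj₁ (pair j<i (Fin.toℕ≤pred[n] i)))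

  ordered : ∀ i j → toℕ i < toℕ j → adj G (p (toℕ i)) (p (toℕ j)) ≡ true ⇔ Consecutive (suc D) i j
  ordered i j i<j = mk⇔ (from C ∘ to P) (from P ∘ to C)
    where
    open Equivalence
    P = proj₂ (pair i<j (Fin.toℕ≤pred[n] j))
    C = cycleAdjacent-< i<j (Fin.toℕ≤pred[n] j)

  adjacency : ∀ i j → adj G (p (toℕ i)) (p (toℕ j)) ≡ true ⇔ Consecutive (suc D) i j
  adjacency i j with <-cmp (toℕ i) (toℕ j)
  ... | tri< i<j _ _ = ordered i j i<j
  ... | tri> _ _ j<i = mk⇔ (Sum.swap ∘ to O ∘ trans (sym G _ _)) (trans (sym G _ _) ∘ from O ∘ Sum.swap)
    where
    open Equivalence
    O = ordered j i j<i
  ... | tri≈ _ i≡j _ with refl ← Fin.toℕ-injective {i = i} {j = j} i≡j =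
    mk⇔ (λ e → contradiction (irrefl G _) (true≢false e))
        (λ e → contradiction (Sum.reduce e) (cycleAdjacent-irrefl 2≤D (Fin.toℕ≤pred[n] i)))

module _ (G : Graph n) (chordal : Chordal G) (p : ℕ → Fin n)
         (edge : ∀ k → adj G (p k) (p (suc k)) ≡ true)
         (fresh : ∀ k → p k ≢ p (2 + k))
         (chordless : ∀ k → adj G (p k) (p (2 + k)) ≡ false) where

  private
    -- Successive vertices are adjacent, so separation starts at index distance 2; hence the offset.
    Far : ℕ → Set
    Far d = ∀ j → p j ≢ p (2 + d + j) × adj G (p j) (p (2 + d + j)) ≡ false

    -- If the two vertices were equal, the edge from `p j` to `p (suc j)` would join `p (suc j)` to
    -- the vertex `2 + d` places after it.
    distinct : ∀ d → Far d → ∀ j → p j ≢ p (3 + d + j)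
    distinct d far j e = true≢false
      (subst (λ x → adj G (p (suc j)) x ≡ true) (trans e (cong p (≡-sym (+-suc (2 + d) j))))
        (trans (sym G _ _) (edge j)))
      (proj₂ (far (suc j)))

    -- Distances from 2 to `2 + d` carry no chord, so the stretch from `j` to `3 + d + j` and the
    -- chord between its ends form an induced cycle.
    closes : ∀ d → (∀ {d'} → d' ≤ d → Far d') → ∀ j → adj G (p j) (p (3 + d + j)) ≡ true →
      InducedCycle G (4 + d)
    closes d far j chord = cycle-of G (λ a → p (a + j)) (3 + d) (s≤s (s≤s z≤n)) pair
      where
      Pair : ℕ → ℕ → Set
      Pair a b = p (a + j) ≢ p (b + j) ×
        (adj G (p (a + j)) (p (b + j)) ≡ true ⇔ (b ≡ suc a ⊎ (a ≡ 0 × b ≡ 3 + d)))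

      gap : ∀ o a → suc o + a ≤ 3 + d → Pair a (suc o + a)
      gap zero a _ =
        (λ e → true≢false (edge (a + j)) (trans (cong (adj G _) (≡-sym e)) (irrefl G _))) ,
        mk⇔ (λ _ → inj₁ refl) (λ _ → edge (a + j))
      gap (suc o) a b≤D with m≤n⇒m<n∨m≡n (m+n≤o⇒m≤o (2 + o) b≤D)
      -- The index difference is `2 + o`. Below `3 + d` it is covered by `far`; at `3 + d` it forces
      -- `a = 0`, and the pair is the closing chord.
      ... | inj₁ (s≤s (s≤s (s≤s o≤d))) rewrite +-assoc o a j =
        proj₁ (far o≤d (a + j)) ,
        mk⇔ (λ e → contradiction (proj₂ (far o≤d (a + j))) (true≢false e)) λ where
          (inj₁ e) → contradiction (≡-sym (suc-injective e)) (m≢1+n+m a)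
          (inj₂ (refl , e)) → contradiction
            (subst (_≤ d) (trans (≡-sym (+-identityʳ o)) (suc-injective (suc-injective e))) o≤d) 1+n≰n
      gap (suc _) (suc a) b≤D | inj₂ refl = contradiction b≤D (m+1+n≰m (3 + d))
      gap (suc _) zero b≤D | inj₂ refl rewrite +-identityʳ d =
        distinct d (far ≤-refl) j , mk⇔ (λ _ → inj₂ (refl , refl)) (λ _ → chord)

      pair : ∀ {a b} → a < b → b ≤ 3 + d → Pair a b
      pair {a} {b} a<b b≤D with m≤n⇒∃[o]m+o≡n a<b
      ... | o , refl = subst (Pair a) eq (gap o a (subst (_≤ 3 + d) (≡-sym eq) b≤D))
        where
        eq : suc o + a ≡ suc a + o
        eq = cong suc (+-comm o a)

    -- Strong induction on the distance: a chord at the first distance not yet treated would close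
    -- an induced cycle on at least 4 vertices.
    far : ∀ d {d'} → d' ≤ d → Far d'
    far _ z≤n j = fresh j , chordless j
    far (suc d) (s≤s {d'} d'≤d) j = distinct d' (far d d'≤d) j ,
      Bool.¬-not λ chord → chordal (4 + d') (m≤m+n 4 d') (closes d' (λ le → far d (≤-trans le d'≤d)) j chord)

  walk-impossible : ⊥
  -- Among the first `suc n` positions some vertex repeats. Distance 1 is excluded by the absence of
  -- loops, larger distances by `far`.
  walk-impossible with Fin.pigeonhole ≤-refl (p ∘ toℕ {suc n})
  ... | i , j , i<j , e with m≤n⇒∃[o]m+o≡n i<j
  ...   | zero , eq = true≢false (edge (toℕ i)) (trans
    (cong (adj G _) (trans (cong p (trans (≡-sym (+-identityʳ _)) eq)) (≡-sym e))) (irrefl G _))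
  ...   | suc o , eq = proj₁ (far o ≤-refl (toℕ i))
    (trans e (cong p (trans (≡-sym eq) (cong suc (+-comm (toℕ i) (suc o))))))

record DominatedEdge (G : Graph n) (W : Subset n) (u v : Fin n) : Set where
  constructor dominatedEdge
  field
    u∈W : u ∈ W
    v∈W : v ∈ W
    v~u : adj G v u ≡ true
    dominated : ∀ w → w ∈ W → adj G v w ≡ true → w ≡ u ⊎ adj G u w ≡ true

dominatedEdge? : (G : Graph n) (W : Subset n) (u v : Fin n) → Dec (DominatedEdge G W u v)
dominatedEdge? G W u v = Dec.map′ (λ (a , b , c , d) → dominatedEdge a b c d)
  (λ (dominatedEdge a b c d) → a , b , c , d)
  ((u ∈? W) ×-dec (v ∈? W) ×-dec (adj G v u Bool.≟ true) ×-dec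
   Fin.all? λ w → (w ∈? W) →-dec (adj G v w Bool.≟ true) →-dec ((w Fin.≟ u) ⊎-dec (adj G u w Bool.≟ true)))

module _ (G : Graph n) (chordal : Chordal G) (W : Subset n) where

  private
    Edge : Set
    Edge = ∃₂ λ u v → u ∈ W × v ∈ W × adj G u v ≡ true

    -- A continuation of the walk after `u`, `v`. It depends on the last two vertices, so the states
    -- of the walk are ordered edges; the last two clauses become `fresh` and `chordless`.
    Escape : Edge → Fin n → Set
    Escape (u , v , _) w = w ∈ W × adj G v w ≡ true × u ≢ w × adj G u w ≡ false

    -- Without an escape every neighbour of `v` in `W` lies in N[u], which makes `u`, `v` a
    -- dominated edge.
    escape : (∀ u v → ¬ DominatedEdge G W u v) → (e : Edge) → ∃ (Escape e)
    escape none (u , v , u∈W , v∈W , u~v) with Fin.any? (λ w →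
      (w ∈? W) ×-dec (adj G v w Bool.≟ true) ×-dec ¬? (u Fin.≟ w) ×-dec (adj G u w Bool.≟ false))
    ... | yes found = found
    ... | no stuck = contradiction (dominatedEdge u∈W v∈W (trans (sym G v u) u~v) caught) (none u v)
      where
      caught : ∀ w → w ∈ W → adj G v w ≡ true → w ≡ u ⊎ adj G u w ≡ true
      caught w w∈W v~w with w Fin.≟ u | adj G u w in eq
      ... | yes w≡u | _ = inj₁ w≡u
      ... | no _ | true = inj₂ refl
      ... | no w≢u | false = contradiction (w , w∈W , v~w , w≢u ∘ ≡-sym , eq) stuck

    step : (∀ e → ∃ (Escape e)) → Edge → Edge
    step esc e@(u , v , _ , v∈W , _) with esc e
    ... | w , w∈W , v~w , _ = v , w , v∈W , w∈W , v~w

    walk : (∀ e → ∃ (Escape e)) → Edge → ℕ → Edge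
    walk esc e zero = e
    walk esc e (suc k) = step esc (walk esc e k)

    all-escape-impossible : (∀ e → ∃ (Escape e)) → ¬ Edge
    all-escape-impossible esc e = walk-impossible G chordal (λ k → proj₁ (walk esc e k))
      (λ k → proj₂ (proj₂ (proj₂ (proj₂ (walk esc e k)))))
      (λ k → proj₁ (proj₂ (proj₂ (proj₂ (esc (walk esc e k))))))
      (λ k → proj₂ (proj₂ (proj₂ (proj₂ (esc (walk esc e k))))))

  dominatedEdge⊎edgeless : (∃₂ λ u v → DominatedEdge G W u v) ⊎ (∀ u v → u ∈ W → v ∈ W → adj G u v ≡ false)
  dominatedEdge⊎edgeless with Fin.any? (λ u → Fin.any? (dominatedEdge? G W u))
  ... | yes found = inj₁ found
  ... | no none = inj₂ λ u v u∈W v∈W → Bool.¬-not λ u~v →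
    all-escape-impossible (escape λ u v d → none (u , v , d)) (u , v , u∈W , v∈W , u~v)

-- Counting subsets

flip : Fin n → Subset n → Subset n
flip x S = updateAt S x not

-- Opaque, since unification could not see through the recursion on n to recover the summand.
opaque
  ∑ : (Subset n → ℕ) → ℕ
  ∑ {zero} h = h []
  ∑ {suc n} h = ∑ (h ∘ (outside ∷_)) + ∑ (h ∘ (inside ∷_))

  ∑-[] : ∀ (h : Subset 0 → ℕ) → ∑ h ≡ h []
  ∑-[] h = refl

  ∑-∷ : ∀ (h : Subset (suc n) → ℕ) → ∑ h ≡ ∑ (h ∘ (outside ∷_)) + ∑ (h ∘ (inside ∷_))
  ∑-∷ h = refl

  ∑-cong : ∀ {h k : Subset n → ℕ} → (∀ S → h S ≡ k S) → ∑ h ≡ ∑ k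
  ∑-cong {zero} e = e []
  ∑-cong {suc n} e = cong₂ _+_ (∑-cong (e ∘ (outside ∷_))) (∑-cong (e ∘ (inside ∷_)))

  ∑-mono : ∀ {h k : Subset n → ℕ} → (∀ S → h S ≤ k S) → ∑ h ≤ ∑ k
  ∑-mono {zero} e = e []
  ∑-mono {suc n} e = +-mono-≤ (∑-mono (e ∘ (outside ∷_))) (∑-mono (e ∘ (inside ∷_)))

  ∑-zero : ∑ {n} (λ _ → 0) ≡ 0
  ∑-zero {zero} = refl
  ∑-zero {suc n} = cong₂ _+_ (∑-zero {n}) (∑-zero {n})

  ∑-+ : ∀ (h k : Subset n → ℕ) → ∑ (λ S → h S + k S) ≡ ∑ h + ∑ k
  ∑-+ {zero} h k = refl
  ∑-+ {suc n} h k = trans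
    (cong₂ _+_ (∑-+ (h ∘ (outside ∷_)) (k ∘ (outside ∷_))) (∑-+ (h ∘ (inside ∷_)) (k ∘ (inside ∷_))))
    (interchange +-commutativeSemigroup (∑ (h ∘ (outside ∷_))) (∑ (k ∘ (outside ∷_)))
      (∑ (h ∘ (inside ∷_))) (∑ (k ∘ (inside ∷_))))

  ∑-*ʳ : ∀ (h : Subset n → ℕ) d → ∑ (λ S → h S * d) ≡ ∑ h * d
  ∑-*ʳ {zero} h d = refl
  ∑-*ʳ {suc n} h d = trans (cong₂ _+_ (∑-*ʳ (h ∘ (outside ∷_)) d) (∑-*ʳ (h ∘ (inside ∷_)) d))
    (≡-sym (*-distribʳ-+ d (∑ (h ∘ (outside ∷_))) (∑ (h ∘ (inside ∷_)))))

  ∑-swap : ∀ {m n} (h : Subset m → Subset n → ℕ) → ∑ (λ S → ∑ (h S)) ≡ ∑ (λ T → ∑ λ S → h S T)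
  ∑-swap {zero} h = refl
  ∑-swap {suc m} h = trans (cong₂ _+_ (∑-swap (h ∘ (outside ∷_))) (∑-swap (h ∘ (inside ∷_))))
    (≡-sym (∑-+ (λ T → ∑ λ S → h (outside ∷ S) T) (λ T → ∑ λ S → h (inside ∷ S) T)))

  -- The subsets are paired as `S`, `flip u S`, and each pair is recorded at its member avoiding
  -- `u`.
  ∑-split : ∀ (u : Fin n) (h : Subset n → ℕ) →
    ∑ h ≡ ∑ (λ S → if lookup S u then 0 else h S + h (flip u S))
  ∑-split {suc n} zero h = ≡-sym (trans
    (cong₂ _+_ (∑-+ (h ∘ (outside ∷_)) (h ∘ (inside ∷_))) (∑-zero {n})) (+-identityʳ _))
  ∑-split {suc n} (suc u) h = cong₂ _+_ (∑-split u (h ∘ (outside ∷_))) (∑-split u (h ∘ (inside ∷_)))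

χ : Bool → ℕ
χ b = if b then 1 else 0

χ-mono : ∀ {a b} → (a ≡ true → b ≡ true) → χ a ≤ χ b
χ-mono {false} _ = z≤n
χ-mono {true} a⇒b = ≤-reflexive (cong χ (≡-sym (a⇒b refl)))

# : (Subset n → Bool) → ℕ
# f = ∑ (χ ∘ f)

dec-sound : ∀ {P : Set} (P? : Dec P) → does P? ≡ true → P
dec-sound (yes p) _ = p

OfSize : Subset n → ℕ → Subset n → Set
OfSize U r T = T ⊆ U × ∣ T ∣ ≡ r

ofSize? : ∀ (U : Subset n) r T → Dec (OfSize U r T)
ofSize? U r T = (T ⊆? U) ×-dec (∣ T ∣ ≟ r)

nC0≡1 : ∀ n → n C 0 ≡ 1
nC0≡1 n = trans (nCk≡nC[n∸k] (z≤n {n})) (nCn≡1 n)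

0<nCk : ∀ {n k} → k ≤ n → 0 < n C k
0<nCk {n} z≤n = ≤-reflexive (≡-sym (nC0≡1 n))
0<nCk (s≤s {k} {n} k≤n) = ≤-trans (≤-trans (0<nCk k≤n) (m≤m+n _ _)) (≤-reflexive (nCk+nC[k+1]≡[n+1]C[k+1] n k))

#-⇔ : ∀ {P Q : Subset n → Set} (P? : ∀ S → Dec (P S)) (Q? : ∀ S → Dec (Q S)) →
  (∀ S → P S ⇔ Q S) → # (does ∘ P?) ≡ # (does ∘ Q?)
#-⇔ P? Q? e = ∑-cong λ S → cong χ (does-⇔ (e S) (P? S) (Q? S))

#-empty : ∀ {P : Subset n → Set} (P? : ∀ S → Dec (P S)) → (∀ S → ¬ P S) → # (does ∘ P?) ≡ 0
#-empty {n} P? none = trans (∑-cong λ S → cong χ (dec-false (P? S) (none S))) (∑-zero {n})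

-- Sets avoiding and sets containing the first element of `U` give the two terms of Pascal's rule.
#-ofSize : ∀ (U : Subset n) r → # (does ∘ ofSize? U r) ≡ ∣ U ∣ C r
#-ofSize [] zero = ∑-[] _
#-ofSize [] (suc r) = trans (∑-[] _) (≡-sym (k>n⇒nCk≡0 {0} {suc r} (s≤s z≤n)))
#-ofSize (x ∷ U) r = trans (∑-∷ _) (step x r)
  where
  avoiding : ∀ x r → # (λ T → does (ofSize? (x ∷ U) r (outside ∷ T))) ≡ ∣ U ∣ C r
  avoiding x r = trans (#-⇔ (ofSize? (x ∷ U) r ∘ (outside ∷_)) (ofSize? U r)
    λ T → mk⇔ (λ (T⊆U , e) → drop-∷-⊆ T⊆U , e) (λ (T⊆U , e) → out⊆ T⊆U , e)) (#-ofSize U r)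

  step : ∀ x r → # (λ T → does (ofSize? (x ∷ U) r (outside ∷ T))) +
    # (λ T → does (ofSize? (x ∷ U) r (inside ∷ T))) ≡ ∣ x ∷ U ∣ C r
  step outside r = trans (cong₂ _+_ (avoiding outside r)
    (#-empty (ofSize? (outside ∷ U) r ∘ (inside ∷_)) λ T (T⊆U , _) → contradiction (T⊆U here) λ ()))
    (+-identityʳ _)
  step inside zero = trans (cong₂ _+_ (trans (avoiding inside zero) (nC0≡1 ∣ U ∣))
    (#-empty (ofSize? (inside ∷ U) zero ∘ (inside ∷_)) λ T → λ ())) (≡-sym (nC0≡1 (suc ∣ U ∣)))
  step inside (suc r) = trans (cong₂ _+_ (avoiding inside (suc r))
    (trans (#-⇔ (ofSize? (inside ∷ U) (suc r) ∘ (inside ∷_)) (ofSize? U r)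
      λ T → mk⇔ (λ (T⊆U , e) → drop-∷-⊆ T⊆U , suc-injective e) (λ (T⊆U , e) → in⊆in T⊆U , cong suc e))
      (#-ofSize U r)))
    (trans (+-comm _ (∣ U ∣ C r)) (nCk+nC[k+1]≡[n+1]C[k+1] ∣ U ∣ r))

∣p∩∁q∣+∣q∣≡∣p∣ : ∀ {p q : Subset n} → q ⊆ p → ∣ p ∩ ∁ q ∣ + ∣ q ∣ ≡ ∣ p ∣
∣p∩∁q∣+∣q∣≡∣p∣ {p = []} {[]} _ = refl
∣p∩∁q∣+∣q∣≡∣p∣ {p = x ∷ p} {inside ∷ q} s with here ← s here =
  trans (+-suc _ _) (cong suc (∣p∩∁q∣+∣q∣≡∣p∣ (drop-∷-⊆ s)))
∣p∩∁q∣+∣q∣≡∣p∣ {p = outside ∷ p} {outside ∷ q} s = ∣p∩∁q∣+∣q∣≡∣p∣ (drop-∷-⊆ s)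
∣p∩∁q∣+∣q∣≡∣p∣ {p = inside ∷ p} {outside ∷ q} s = cong suc (∣p∩∁q∣+∣q∣≡∣p∣ (drop-∷-⊆ s))

∧-trueʳ : ∀ a {b} → a ∧ b ≡ true → b ≡ true
∧-trueʳ true e = e

-- Cross-intersecting families of r-subsets

Family : ℕ → Set
Family n = Subset n → Bool

_⊑_ : Family n → (Subset n → Set) → Set
f ⊑ P = ∀ S → f S ≡ true → P S

Cross : Family n → Family n → Set
Cross f g = ∀ S T → f S ≡ true → g T ≡ true → Nonempty (S ∩ T)

module _ (W : Subset n) (r : ℕ) (2r≤∣W∣ : 2 * r ≤ ∣ W ∣) where

  private
    degree : ℕ
    degree = (∣ W ∣ ∸ r) C r

    -- From `2 * r ≤ ∣ W ∣` follows `r ≤ ∣ W ∣ ∸ r`, so the degree is positive and can be cancelled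
    -- at the end.
    instance
      degree-nonZero : NonZero degree
      degree-nonZero = >-nonZero (0<nCk (m+n≤o⇒m≤o∸n r
        (subst (λ x → r + x ≤ ∣ W ∣) (+-identityʳ r) 2r≤∣W∣)))

    Disjoint : Subset n → Subset n → Set
    Disjoint S T = OfSize W r S × OfSize W r T × ¬ Nonempty (S ∩ T)

    disjoint? : ∀ S T → Dec (Disjoint S T)
    disjoint? S T = ofSize? W r S ×-dec ofSize? W r T ×-dec ¬? (nonempty? (S ∩ T))

    disjoint-sym : ∀ S T → Disjoint S T → Disjoint T S
    disjoint-sym S T (s , t , d) = t , s , subst (¬_ ∘ Nonempty) (∩-comm S T) d

    -- The neighbours of `S` are the r-subsets of W minus S, a set of size `∣ W ∣ ∸ r`.
    #-disjoint : ∀ S → OfSize W r S → # (does ∘ disjoint? S) ≡ degree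
    #-disjoint S s@(S⊆W , ∣S∣≡r) = trans (#-⇔ (disjoint? S) (ofSize? (W ∩ ∁ S) r) λ T → mk⇔
      (λ (_ , (T⊆W , e) , d) → (λ x∈T → x∈p∩q⁺ (T⊆W x∈T , x∉p⇒x∈∁p λ x∈S → d (_ , x∈p∩q⁺ (x∈S , x∈T)))) , e)
      (λ (T⊆ , e) → s , (p∩q⊆p W (∁ S) ∘ T⊆ , e) , λ (x , x∈S∩T) →
        x∈∁p⇒x∉p (p∩q⊆q W (∁ S) (T⊆ (p∩q⊆q S T x∈S∩T))) (p∩q⊆p S T x∈S∩T)))
      (trans (#-ofSize (W ∩ ∁ S) r) (cong (_C r) size))
      where
      size : ∣ W ∩ ∁ S ∣ ≡ ∣ W ∣ ∸ r
      size = trans (≡-sym (m+n∸n≡m _ r))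
        (cong (_∸ r) (trans (cong (∣ W ∩ ∁ S ∣ +_) (≡-sym ∣S∣≡r)) (∣p∩∁q∣+∣q∣≡∣p∣ S⊆W)))

  -- The edges leaving `f` are counted at their other end `T`. A member `T` of `g` receives none and
  -- is charged `degree` on its own account; any other r-set receives at most `degree`. So no r-set
  -- is charged more than `degree`.
  kneser : ∀ {f g} → f ⊑ OfSize W r → g ⊑ OfSize W r → Cross f g →
    # f + # g ≤ # (does ∘ ofSize? W r)
  kneser {f} {g} f⊑ g⊑ cross = *-cancelʳ-≤ _ _ degree (begin
    (# f + # g) * degree ≡⟨ *-distribʳ-+ degree (# f) (# g) ⟩
    # f * degree + # g * degree ≡⟨ cong₂ _+_ (≡-sym edges) (≡-sym (∑-*ʳ (χ ∘ g) degree)) ⟩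
    ∑ (λ T → ∑ λ S → χ (f S ∧ does (disjoint? S T))) + ∑ (λ T → χ (g T) * degree) ≡⟨ ∑-+ _ _ ⟨
    ∑ (λ T → ∑ (λ S → χ (f S ∧ does (disjoint? S T))) + χ (g T) * degree)
      ≤⟨ ∑-mono (λ T → bound T (g T) refl (ofSize? W r T)) ⟩
    ∑ (λ T → χ (does (ofSize? W r T)) * degree) ≡⟨ ∑-*ʳ _ degree ⟩
    # (does ∘ ofSize? W r) * degree ∎)
    where
    open ≤-Reasoning
    edges : ∑ (λ T → ∑ λ S → χ (f S ∧ does (disjoint? S T))) ≡ # f * degree
    edges = trans (∑-swap _) (trans (∑-cong row) (∑-*ʳ (χ ∘ f) degree))
      where
      row : ∀ S → # (λ T → f S ∧ does (disjoint? S T)) ≡ χ (f S) * degree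
      row S with f S in eq
      ... | false = ∑-zero {n}
      ... | true = trans (#-disjoint S (f⊑ S eq)) (≡-sym (*-identityˡ degree))
    bound : ∀ T (b : Bool) → g T ≡ b → (t? : Dec (OfSize W r T)) →
      # (λ S → f S ∧ does (disjoint? S T)) + χ b * degree ≤ χ (does t?) * degree
    bound T true gT (no t) = contradiction (g⊑ T gT) t
    bound T true gT (yes _) = +-monoˡ-≤ (1 * degree) (≤-reflexive (trans (∑-cong none) (∑-zero {n})))
      where
      none : ∀ S → χ (f S ∧ does (disjoint? S T)) ≡ 0
      none S with f S in fS
      ... | false = refl
      ... | true = cong χ (dec-false (disjoint? S T) λ (_ , _ , d) → d (cross S T fS gT))
    bound T false gT (no t) = ≤-reflexive (trans (+-identityʳ _) (trans (∑-cong none) (∑-zero {n})))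
      where
      none : ∀ S → χ (f S ∧ does (disjoint? S T)) ≡ 0
      none S = cong χ (trans (cong (f S ∧_) (dec-false (disjoint? S T) (t ∘ proj₁ ∘ proj₂))) (Bool.∧-zeroʳ (f S)))
    bound T false gT (yes t) = begin
      # (λ S → f S ∧ does (disjoint? S T)) + 0 ≡⟨ +-identityʳ _ ⟩
      # (λ S → f S ∧ does (disjoint? S T)) ≤⟨ ∑-mono (λ S → χ-mono (λ e →
        dec-true (disjoint? T S) (disjoint-sym S T (dec-sound (disjoint? S T) (∧-trueʳ (f S) e))))) ⟩
      # (does ∘ disjoint? T) ≡⟨ #-disjoint T t ⟩
      degree ≡⟨ *-identityˡ degree ⟨
      1 * degree ∎

-- Compression along a dominated edge

∉⇒lookup : ∀ {x} {S : Subset n} → x ∉ S → lookup S x ≡ false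
∉⇒lookup {x = x} {S} x∉S = Bool.¬-not (x∉S ∘ lookup⇒[]= x S)

lookup⇒∉ : ∀ {x} {S : Subset n} → lookup S x ≡ false → x ∉ S
lookup⇒∉ e x∈S = true≢false ([]=⇒lookup x∈S) e

flip-flip : ∀ u (S : Subset n) → flip u (flip u S) ≡ S
flip-flip u S = trans (updateAt-updateAt u S) (updateAt-id-local u S (Bool.not-involutive _))

∈-flip⁺ : ∀ {x u} {S : Subset n} → x ≢ u → x ∈ S → x ∈ flip u S
∈-flip⁺ {x = x} {u} {S} x≢u x∈S = lookup⇒[]= x _ (trans (lookup∘updateAt′ x u x≢u S) ([]=⇒lookup x∈S))

∈-flip⁻ : ∀ {x u} {S : Subset n} → x ≢ u → x ∈ flip u S → x ∈ S
∈-flip⁻ {x = x} {u} {S} x≢u x∈ = lookup⇒[]= x S (trans (≡-sym (lookup∘updateAt′ x u x≢u S)) ([]=⇒lookup x∈))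

flip-∋ : ∀ {u} {S : Subset n} → u ∉ S → u ∈ flip u S
flip-∋ {u = u} {S} u∉S = lookup⇒[]= u _ (trans (lookup∘updateAt u S) (cong not (∉⇒lookup u∉S)))

flip-∌ : ∀ {u} {S : Subset n} → u ∈ S → u ∉ flip u S
flip-∌ {u = u} {S} u∈S = lookup⇒∉ (trans (lookup∘updateAt u S) (cong not ([]=⇒lookup u∈S)))

⊆-flip : ∀ {u} {S : Subset n} → u ∉ S → S ⊆ flip u S
⊆-flip u∉S x∈S = ∈-flip⁺ (λ { refl → u∉S x∈S }) x∈S

∣flip∣ : ∀ {u} {S : Subset n} → u ∉ S → ∣ flip u S ∣ ≡ suc ∣ S ∣
∣flip∣ {u = zero} {outside ∷ S} _ = refl
∣flip∣ {u = zero} {inside ∷ S} u∉S = contradiction here u∉S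
∣flip∣ {u = suc u} {outside ∷ S} u∉S = ∣flip∣ {u = u} (u∉S ∘ there)
∣flip∣ {u = suc u} {inside ∷ S} u∉S = cong suc (∣flip∣ {u = u} (u∉S ∘ there))

-- As `v` is in `S`, flipping it can only remove it, so `u` is the only possible new element.
unshift : ∀ {u v x} {S : Subset n} → u ≢ v → x ≢ u → v ∈ S → x ∈ flip u (flip v S) → x ∈ S
unshift {v = v} {x} u≢v x≢u v∈S x∈ with x Fin.≟ v
... | yes refl = v∈S
... | no x≢v = ∈-flip⁻ x≢v (∈-flip⁻ x≢u x∈)

-- The members avoiding u (shifted), and the links of u in the members containing u (linked), of the
-- family obtained from f by replacing u by v.
shifted linked : Fin n → Fin n → Family n → Family n
shifted u v f S = not (lookup S u) ∧ (f S ∨ (lookup S v ∧ f (flip u (flip v S))))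
linked u v f S = not (lookup S u) ∧ (f (flip u S) ∧ f (flip v S))

shifted⁻ : ∀ {u v} {f : Family n} S → shifted u v f S ≡ true →
  u ∉ S × (f S ≡ true ⊎ (v ∈ S × f (flip u (flip v S)) ≡ true))
shifted⁻ {u = u} {v} {f} S e with lookup S u in S∌u
... | false with f S in fS
...   | true = lookup⇒∉ S∌u , inj₁ refl
...   | false with lookup S v in S∋v
...     | true = lookup⇒∉ S∌u , inj₂ (lookup⇒[]= v S S∋v , e)

linked⁻ : ∀ {u v} {f : Family n} S → linked u v f S ≡ true →
  u ∉ S × f (flip u S) ≡ true × f (flip v S) ≡ true
linked⁻ {u = u} {v} {f} S e with lookup S u in S∌u
... | false with f (flip u S) in fS
...   | true = lookup⇒∉ S∌u , refl , e

χ-∨-∧ : ∀ a b → χ (a ∨ b) + χ (b ∧ a) ≡ χ b + χ a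
χ-∨-∧ false false = refl
χ-∨-∧ false true = refl
χ-∨-∧ true false = refl
χ-∨-∧ true true = refl

-- Subsets are grouped into quadruples S, S + u, S + v, S + u + v with u, v outside S. By hypothesis
-- `f` is false at S + u + v. Of its values at S + u and S + v, `shifted` counts the disjunction at
-- S + v and `linked` the conjunction at S, and together these count both values.
#-shifted : ∀ {u v} {f : Family n} → u ≢ v → (∀ S → u ∈ S → v ∈ S → f S ≡ false) →
  # (shifted u v f) + # (linked u v f) ≡ # f
#-shifted {u = u} {v} {f} u≢v noBoth = begin
  # (shifted u v f) + # (linked u v f) ≡⟨ cong₂ _+_ (∑-quarters _) (∑-quarters _) ⟩
  ∑ (quarters (χ ∘ shifted u v f)) + ∑ (quarters (χ ∘ linked u v f)) ≡⟨ ∑-+ _ _ ⟨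
  ∑ (λ S → quarters (χ ∘ shifted u v f) S + quarters (χ ∘ linked u v f) S) ≡⟨ ∑-cong pointwise ⟩
  ∑ (quarters (χ ∘ f)) ≡⟨ ∑-quarters _ ⟨
  # f ∎
  where
  open ≡-Reasoning
  quarters : (Subset _ → ℕ) → Subset _ → ℕ
  quarters h S = if lookup S v then 0 else
    if lookup S u then 0 else (h S + h (flip u S)) + (h (flip v S) + h (flip u (flip v S)))

  ∑-quarters : ∀ h → ∑ h ≡ ∑ (quarters h)
  ∑-quarters h = trans (∑-split u h) (trans (∑-split v _) (∑-cong merge))
    where
    merge : ∀ S → (if lookup S v then 0 else
      (if lookup S u then 0 else h S + h (flip u S)) +
      (if lookup (flip v S) u then 0 else h (flip v S) + h (flip u (flip v S)))) ≡ quarters h S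
    merge S rewrite lookup∘updateAt′ u v {not} u≢v S with lookup S v | lookup S u
    ... | true | _ = refl
    ... | false | true = refl
    ... | false | false = refl

  pointwise : ∀ S → quarters (χ ∘ shifted u v f) S + quarters (χ ∘ linked u v f) S ≡ quarters (χ ∘ f) S
  pointwise S with lookup S v in S∌v
  ... | true = refl
  ... | false with lookup S u in S∌u
  ...   | true = refl
  ...   | false
    rewrite lookup∘updateAt u {not} S | lookup∘updateAt u {not} (flip v S)
          | lookup∘updateAt′ u v {not} u≢v S | lookup∘updateAt v {not} S | S∌u | S∌v
          | flip-flip v S
          | noBoth (flip u (flip v S)) (flip-∋ (lookup⇒∉ (trans (lookup∘updateAt′ u v u≢v S) S∌u)))
              (∈-flip⁺ (u≢v ∘ ≡-sym) (flip-∋ (lookup⇒∉ S∌v)))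
          with f S | f (flip u S) | f (flip v S)
  ...     | false | false | false = refl
  ...     | false | false | true = refl
  ...     | false | true | false = refl
  ...     | false | true | true = refl
  ...     | true | false | false = refl
  ...     | true | false | true = refl
  ...     | true | true | false = refl
  ...     | true | true | true = refl

-- Independent sets of induced subgraphs

remove : Subset n → Fin n → Subset n
remove W u = W ∩ ∁ ⁅ u ⁆

∈-remove⁺ : ∀ {W : Subset n} {u x} → x ∈ W → x ≢ u → x ∈ remove W u
∈-remove⁺ x∈W x≢u = x∈p∩q⁺ (x∈W , x∉p⇒x∈∁p (x≢y⇒x∉⁅y⁆ x≢u))

∈-remove⁻ : ∀ {W : Subset n} {u x} → x ∈ remove W u → x ∈ W × x ≢ u
∈-remove⁻ {W = W} {u} x∈ with x∈p∩q⁻ W (∁ ⁅ u ⁆) x∈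
... | x∈W , x∈∁ = x∈W , x∉⁅y⁆⇒x≢y (x∈∁p⇒x∉p x∈∁)

module _ (G : Graph n) where

  IndependentIn : Subset n → ℕ → Subset n → Set
  IndependentIn W r S = S ⊆ W × Independent G S × ∣ S ∣ ≡ r

  independent? : ∀ S → Dec (Independent G S)
  independent? S = Fin.all? λ i → Fin.all? λ j → (i ∈? S) →-dec (j ∈? S) →-dec (adj G i j Bool.≟ false)

  independentIn? : ∀ W r S → Dec (IndependentIn W r S)
  independentIn? W r S = (S ⊆? W) ×-dec independent? S ×-dec (∣ S ∣ ≟ r)

  -- Maximality is stated as domination: the neighbour it provides is what gets carried over when
  -- the vertex set changes.
  MaximalIn : Subset n → Subset n → Set
  MaximalIn W I = I ⊆ W × Independent G I × (∀ w → w ∈ W → w ∉ I → ∃ λ x → x ∈ I × adj G x w ≡ true)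

  independent-⊆ : ∀ {S T} → S ⊆ T → Independent G T → Independent G S
  independent-⊆ S⊆T ind i j i∈S j∈S = ind i j (S⊆T i∈S) (S⊆T j∈S)

  independent-flip : ∀ {u S} → Independent G S → (∀ x → x ∈ S → adj G u x ≡ false) → Independent G (flip u S)
  independent-flip {u} ind far i j i∈ j∈ with i Fin.≟ u | j Fin.≟ u
  ... | yes refl | yes refl = irrefl G u
  ... | yes refl | no j≢u = far j (∈-flip⁻ j≢u j∈)
  ... | no i≢u | yes refl = trans (sym G i u) (far i (∈-flip⁻ i≢u i∈))
  ... | no i≢u | no j≢u = ind i j (∈-flip⁻ i≢u i∈) (∈-flip⁻ j≢u j∈)

  removeClosedNbhd : Subset n → Fin n → Subset n
  removeClosedNbhd W u = remove W u ∩ ∁ (tabulate (adj G u))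

  ∈-removeClosedNbhd⁺ : ∀ {W u x} → x ∈ W → x ≢ u → adj G u x ≡ false → x ∈ removeClosedNbhd W u
  ∈-removeClosedNbhd⁺ {x = x} x∈W x≢u u≁x = x∈p∩q⁺ (∈-remove⁺ x∈W x≢u ,
    x∉p⇒x∈∁p (lookup⇒∉ (trans (lookup∘tabulate _ x) u≁x)))

  ∈-removeClosedNbhd⁻ : ∀ {W u x} → x ∈ removeClosedNbhd W u → x ∈ W × x ≢ u × adj G u x ≡ false
  ∈-removeClosedNbhd⁻ {W} {u} {x} x∈ with x∈p∩q⁻ (remove W u) _ x∈
  ... | x∈W-u , x∈∁ with ∈-remove⁻ {W = W} x∈W-u
  ...   | x∈W , x≢u = x∈W , x≢u , trans (≡-sym (lookup∘tabulate _ x)) (∉⇒lookup (x∈∁p⇒x∉p x∈∁))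

  -- In each pair `S`, `flip u S` with `u` outside `S`, a set counted by deletion is `S` itself, and
  -- a set counted by the link gives S + u.
  #-deletion-link : ∀ W {u} r → u ∈ W →
    # (does ∘ independentIn? (remove W u) (suc r)) + # (does ∘ independentIn? (removeClosedNbhd W u) r) ≤
    # (does ∘ independentIn? W (suc r))
  #-deletion-link W {u} r u∈W = begin
    # deleted + # link ≡⟨ ∑-+ _ _ ⟨
    ∑ (λ S → χ (deleted S) + χ (link S)) ≤⟨ ∑-mono bound ⟩
    ∑ (λ S → if lookup S u then 0 else χ (all S) + χ (all (flip u S))) ≡⟨ ∑-split u _ ⟨
    # all ∎
    where
    open ≤-Reasoning
    deleted link all : Family n
    deleted = does ∘ independentIn? (remove W u) (suc r)
    link = does ∘ independentIn? (removeClosedNbhd W u) r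
    all = does ∘ independentIn? W (suc r)
    bound : ∀ S → χ (deleted S) + χ (link S) ≤ (if lookup S u then 0 else χ (all S) + χ (all (flip u S)))
    bound S with lookup S u in S∋u
    ... | true = ≤-reflexive (cong₂ (λ a b → χ a + χ b)
        (dec-false (independentIn? (remove W u) (suc r) S)
          λ (s , _) → proj₂ (∈-remove⁻ {W = W} (s u∈S)) refl)
        (dec-false (independentIn? (removeClosedNbhd W u) r S)
          λ (s , _) → proj₁ (proj₂ (∈-removeClosedNbhd⁻ {W} (s u∈S))) refl))
      where
      u∈S = lookup⇒[]= u S S∋u
    ... | false = +-mono-≤
      (χ-mono λ e → dec-true (independentIn? W (suc r) S)
        (let s , i , c = dec-sound (independentIn? (remove W u) (suc r) S) e
         in proj₁ ∘ ∈-remove⁻ {W = W} ∘ s , i , c))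
      (χ-mono λ e → dec-true (independentIn? W (suc r) (flip u S))
        (extend (dec-sound (independentIn? (removeClosedNbhd W u) r S) e)))
      where
      extend : IndependentIn (removeClosedNbhd W u) r S → IndependentIn W (suc r) (flip u S)
      extend (s , i , c) = sub ,
        independent-flip i (λ x x∈S → proj₂ (proj₂ (∈-removeClosedNbhd⁻ {W} (s x∈S)))) ,
        trans (∣flip∣ {S = S} (lookup⇒∉ S∋u)) (cong suc c)
        where
        sub : flip u S ⊆ W
        sub {x} x∈ with x Fin.≟ u
        ... | yes refl = u∈W
        ... | no x≢u = proj₁ (∈-removeClosedNbhd⁻ {W} (s (∈-flip⁻ x≢u x∈)))

  module _ {W u v} (d : DominatedEdge G W u v) where
    open DominatedEdge d

    u≢v : u ≢ v
    u≢v refl = true≢false v~u (irrefl G u)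

    -- Two sets that both arise by replacement share `v`. If only `T` does, then `S` meets T - v + u
    -- in a point other than `u`, as `u` is not in `S`, and that point lies in `T`.
    shifted-cross : ∀ {f g} → Cross f g → Cross (shifted u v f) (shifted u v g)
    shifted-cross {f} {g} cross S T S∈ T∈ with shifted⁻ {f = f} S S∈ | shifted⁻ {f = g} T T∈
    ... | _ , inj₁ fS | _ , inj₁ gT = cross S T fS gT
    ... | _ , inj₂ (v∈S , _) | _ , inj₂ (v∈T , _) = v , x∈p∩q⁺ (v∈S , v∈T)
    ... | u∉S , inj₁ fS | _ , inj₂ (v∈T , gT) with cross S _ fS gT
    ...   | x , x∈ with x∈p∩q⁻ S _ x∈
    ...     | x∈S , x∈T′ = x , x∈p∩q⁺ (x∈S , unshift u≢v (λ { refl → u∉S x∈S }) v∈T x∈T′)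
    shifted-cross cross S T _ _ | _ , inj₂ (v∈S , fS) | u∉T , inj₁ gT with cross _ T fS gT
    ...   | x , x∈ with x∈p∩q⁻ _ T x∈
    ...     | x∈S′ , x∈T = x , x∈p∩q⁺ (unshift u≢v (λ { refl → u∉T x∈T }) v∈S x∈S′ , x∈T)

    link-avoids : ∀ {r S} → u ∉ S → IndependentIn W r (flip u S) → v ∉ S
    link-avoids u∉S (_ , ind , _) v∈S = true≢false v~u (ind v u (⊆-flip u∉S v∈S) (flip-∋ u∉S))

    -- The hypothesis is applied to S + u and T + v. A common point is not `u`, which is outside
    -- `T`, and not `v`, which is outside `S` because S + u is independent; so it lies in both
    -- links.
    linked-cross : ∀ {f g r} → f ⊑ IndependentIn W r → g ⊑ IndependentIn W r → Cross f g →
      Cross (linked u v f) (linked u v g)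
    linked-cross {f} {g} f⊑ g⊑ cross S T S∈ T∈ with linked⁻ {f = f} S S∈ | linked⁻ {f = g} T T∈
    ... | u∉S , fSu , _ | u∉T , gTu , gTv with cross (flip u S) (flip v T) fSu gTv
    ...   | x , x∈ with x∈p∩q⁻ (flip u S) _ x∈ | x Fin.≟ u | x Fin.≟ v
    ...     | _ , x∈Tv | yes refl | _ = contradiction (∈-flip⁻ u≢v x∈Tv) u∉T
    ...     | x∈Su , _ | no x≢u | yes refl = contradiction (∈-flip⁻ x≢u x∈Su) (link-avoids u∉S (f⊑ _ fSu))
    ...     | x∈Su , x∈Tv | no x≢u | no x≢v = x , x∈p∩q⁺ (∈-flip⁻ x≢u x∈Su , ∈-flip⁻ x≢v x∈Tv)

    -- Domination enters in the replaced case: a neighbour of `v` in S - v would equal `u` or be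
    -- adjacent to `u`, yet S - v + u is independent and `u` is not in S - v.
    shifted-⊑ : ∀ {f r} → f ⊑ IndependentIn W r → shifted u v f ⊑ IndependentIn (remove W u) r
    shifted-⊑ {f} {r} f⊑ S S∈ with shifted⁻ {f = f} S S∈
    ... | u∉S , inj₁ fS with f⊑ S fS
    ...   | S⊆W , ind , size = (λ x∈S → ∈-remove⁺ (S⊆W x∈S) λ { refl → u∉S x∈S }) , ind , size
    shifted-⊑ {f} {r} f⊑ S S∈ | u∉S , inj₂ (v∈S , fT) with f⊑ _ fT
    ...   | T⊆W , ind , size = (λ x∈S → ∈-remove⁺ (S⊆W x∈S) λ { refl → u∉S x∈S }) ,
      subst (Independent G) (flip-flip v S) (independent-flip (independent-⊆ (⊆-flip u∉S′) ind) nonadjacent) ,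
      trans (cong ∣_∣ (≡-sym (flip-flip v S)))
        (trans (∣flip∣ {S = flip v S} (flip-∌ v∈S)) (trans (≡-sym (∣flip∣ {S = flip v S} u∉S′)) size))
      where
      u∉S′ : u ∉ flip v S
      u∉S′ = u∉S ∘ ∈-flip⁻ u≢v
      S⊆W : S ⊆ W
      S⊆W {x} x∈S with x Fin.≟ v
      ... | yes refl = v∈W
      ... | no x≢v = T⊆W (⊆-flip u∉S′ (∈-flip⁺ x≢v x∈S))
      nonadjacent : ∀ x → x ∈ flip v S → adj G v x ≡ false
      nonadjacent x x∈ = Bool.¬-not λ v~x →
        [ (λ { refl → u∉S′ x∈ }) , (λ u~x → true≢false u~x (ind u x (flip-∋ u∉S′) (⊆-flip u∉S′ x∈))) ]′
          (dominated x (T⊆W (⊆-flip u∉S′ x∈)) v~x)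

    linked-⊑ : ∀ {f r} → f ⊑ IndependentIn W (suc r) → linked u v f ⊑ IndependentIn (removeClosedNbhd W u) r
    linked-⊑ {f} f⊑ S S∈ with linked⁻ {f = f} S S∈
    ... | u∉S , fSu , _ with f⊑ _ fSu
    ...   | Su⊆W , ind , size =
      (λ {x} x∈S → ∈-removeClosedNbhd⁺ (Su⊆W (⊆-flip u∉S x∈S)) (λ { refl → u∉S x∈S })
        (ind u x (flip-∋ u∉S) (⊆-flip u∉S x∈S))) ,
      independent-⊆ (⊆-flip u∉S) ind ,
      suc-injective (trans (≡-sym (∣flip∣ {S = S} u∉S)) size)

    -- I meets N[v], as v itself belongs to W - u, hence I meets N[u]: so I dominates u as well.
    maximalIn-delete : ∀ {I} → MaximalIn (remove W u) I → MaximalIn W I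
    maximalIn-delete {I} (I⊆ , ind , dom) = proj₁ ∘ I⊆W-u , ind , dom′
      where
      I⊆W-u : ∀ {x} → x ∈ I → x ∈ W × x ≢ u
      I⊆W-u = ∈-remove⁻ {W = W} ∘ I⊆
      dom-u : ∃ λ x → x ∈ I × adj G x u ≡ true
      dom-u with v ∈? I
      ... | yes v∈I = v , v∈I , v~u
      ... | no v∉I with dom v (∈-remove⁺ v∈W (u≢v ∘ ≡-sym)) v∉I
      ...   | x , x∈I , x~v with dominated x (proj₁ (I⊆W-u x∈I)) (trans (sym G v x) x~v)
      ...     | inj₁ x≡u = contradiction x≡u (proj₂ (I⊆W-u x∈I))
      ...     | inj₂ u~x = x , x∈I , trans (sym G x u) u~x
      dom′ : ∀ w → w ∈ W → w ∉ I → ∃ λ x → x ∈ I × adj G x w ≡ true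
      dom′ w w∈W w∉I with w Fin.≟ u
      ... | yes refl = dom-u
      ... | no w≢u = dom w (∈-remove⁺ w∈W w≢u) w∉I

  -- The vertices put back are `u` and neighbours of `u`, and the latter are dominated by `u`.
  maximalIn-link : ∀ {W u I} → u ∈ W → MaximalIn (removeClosedNbhd W u) I → u ∉ I × MaximalIn W (flip u I)
  maximalIn-link {W} {u} {I} u∈W (I⊆ , ind , dom) =
    u∉I , sub , independent-flip ind (λ x → proj₂ ∘ proj₂ ∘ I⊆⁻) , dom′
    where
    I⊆⁻ : ∀ {x} → x ∈ I → x ∈ W × x ≢ u × adj G u x ≡ false
    I⊆⁻ = ∈-removeClosedNbhd⁻ {W} ∘ I⊆
    u∉I : u ∉ I
    u∉I u∈I = proj₁ (proj₂ (I⊆⁻ u∈I)) refl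
    sub : flip u I ⊆ W
    sub {x} x∈ with x Fin.≟ u
    ... | yes refl = u∈W
    ... | no x≢u = proj₁ (I⊆⁻ (∈-flip⁻ x≢u x∈))
    dom′ : ∀ w → w ∈ W → w ∉ flip u I → ∃ λ x → x ∈ flip u I × adj G x w ≡ true
    dom′ w w∈W w∉ with w Fin.≟ u | adj G u w in u?w
    ... | yes refl | _ = contradiction (flip-∋ u∉I) w∉
    ... | no _ | true = u , flip-∋ u∉I , u?w
    ... | no w≢u | false with dom w (∈-removeClosedNbhd⁺ w∈W w≢u u?w) (w∉ ∘ ⊆-flip u∉I)
    ...   | x , x∈I , x~w = x , ⊆-flip u∉I x∈I , x~w

  -- Induction on the vertex set

  Bound : Subset n → ℕ → Set
  Bound W r = ∀ {f g} → f ⊑ IndependentIn W r → g ⊑ IndependentIn W r → Cross f g →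
    # f + # g ≤ # (does ∘ independentIn? W r)

  -- Asking only the r-sets to be independent lets this cover `r = 0` as well, whatever the edges of
  -- G[W].
  bound-edgeless : ∀ W r → 2 * r ≤ ∣ W ∣ → (∀ S → OfSize W r S → Independent G S) → Bound W r
  bound-edgeless W r 2r≤∣W∣ ind f⊑ g⊑ cross = ≤-trans
    (kneser W r 2r≤∣W∣ (λ S e → forget (f⊑ S e)) (λ S e → forget (g⊑ S e)) cross)
    (∑-mono λ S → χ-mono λ e → dec-true (independentIn? W r S)
      (let S⊆W , size = dec-sound (ofSize? W r S) e in S⊆W , ind S (S⊆W , size) , size))
    where
    forget : ∀ {S} → IndependentIn W r S → OfSize W r S
    forget (S⊆W , _ , size) = S⊆W , size

  bound-dominatedEdge : ∀ {W u v r} → DominatedEdge G W u v →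
    Bound (remove W u) (suc r) → Bound (removeClosedNbhd W u) r → Bound W (suc r)
  bound-dominatedEdge {W} {u} {v} {r} d deletion link {f} {g} f⊑ g⊑ cross = begin
    # f + # g ≡⟨ cong₂ _+_ (#-shifted (u≢v d) (noBoth f⊑)) (#-shifted (u≢v d) (noBoth g⊑)) ⟨
    (# (shifted u v f) + # (linked u v f)) + (# (shifted u v g) + # (linked u v g))
      ≡⟨ interchange +-commutativeSemigroup (# (shifted u v f)) _ _ _ ⟩
    (# (shifted u v f) + # (shifted u v g)) + (# (linked u v f) + # (linked u v g))
      ≤⟨ +-mono-≤ (deletion (shifted-⊑ d f⊑) (shifted-⊑ d g⊑) (shifted-cross d cross))
                  (link (linked-⊑ d f⊑) (linked-⊑ d g⊑) (linked-cross d f⊑ g⊑ cross)) ⟩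
    # (does ∘ independentIn? (remove W u) (suc r)) + # (does ∘ independentIn? (removeClosedNbhd W u) r)
      ≤⟨ #-deletion-link W r u∈W ⟩
    # (does ∘ independentIn? W (suc r)) ∎
    where
    open ≤-Reasoning
    open DominatedEdge d
    noBoth : ∀ {h} → h ⊑ IndependentIn W (suc r) → ∀ S → u ∈ S → v ∈ S → h S ≡ false
    noBoth h⊑ S u∈S v∈S = Bool.¬-not λ hS →
      true≢false v~u (proj₁ (proj₂ (h⊑ S hS)) v u v∈S u∈S)

  -- The condition on `r` ranges over the maximal independent sets of G[W]. It passes to the smaller
  -- graphs because a maximal set there is maximal in G[W], after adding `u` in the case of the
  -- link.
  bound : Chordal G → ∀ k W → ∣ W ∣ < k → ∀ r → (∀ I → MaximalIn W I → 2 * r ≤ ∣ I ∣) → Bound W r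
  bound chordal (suc k) W _ zero _ = bound-edgeless W 0 z≤n
    λ S (_ , ∣S∣≡0) i _ i∈S _ → contradiction (<-≤-trans (x∈p⇒∣p-x∣<∣p∣ i∈S) (≤-reflexive ∣S∣≡0)) λ ()
  bound chordal (suc k) W (s≤s ∣W∣≤k) (suc r) large with dominatedEdge⊎edgeless G chordal W
  ... | inj₂ edgeless = bound-edgeless W (suc r)
    -- Without edges `W` is itself a maximal independent set.
    (large W (⊆-refl , edgeless , λ w w∈W w∉W → contradiction w∈W w∉W))
    λ S (S⊆W , _) i j i∈S j∈S → edgeless i j (S⊆W i∈S) (S⊆W j∈S)
  ... | inj₁ (u , v , d) = bound-dominatedEdge d
    (bound chordal k (remove W u) (smaller (proj₁ ∘ ∈-remove⁻ {W = W}) λ u∈ → proj₂ (∈-remove⁻ {W = W} u∈) refl)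
      (suc r) λ I → large I ∘ maximalIn-delete d)
    (bound chordal k (removeClosedNbhd W u) (smaller (proj₁ ∘ ∈-removeClosedNbhd⁻ {W})
      λ u∈ → proj₁ (proj₂ (∈-removeClosedNbhd⁻ {W} u∈)) refl) r large-link)
    where
    open DominatedEdge d
    smaller : ∀ {W′} → W′ ⊆ W → u ∉ W′ → ∣ W′ ∣ < k
    smaller W′⊆W u∉W′ = <-≤-trans (p⊂q⇒∣p∣<∣q∣ (W′⊆W , u , u∈W , u∉W′)) ∣W∣≤k
    large-link : ∀ I → MaximalIn (removeClosedNbhd W u) I → 2 * r ≤ ∣ I ∣
    large-link I max with maximalIn-link u∈W max
    -- From 2(r + 1) ≤ ∣I∣ + 1 one gets 2r + 1 ≤ ∣I∣, one more than required.
    ... | u∉I , max′ = ≤-trans (+-monoʳ-≤ r (n≤1+n (r + 0))) (≤-pred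
      (≤-trans (large (flip u I) max′) (≤-reflexive (∣flip∣ {S = I} u∉I))))

-- Boolean tests and duplicate-free lists

∈-allFin : ∀ (i : Fin n) → i ∈ₗ allFin n
∈-allFin zero = here refl
∈-allFin (suc i) = there (∈-map⁺ suc (∈-allFin i))

∈-allSubsets : ∀ (S : Subset n) → S ∈ₗ allSubsets n
∈-allSubsets [] = here refl
∈-allSubsets (outside ∷ S) = ∈-++⁺ˡ (∈-map⁺ (outside ∷_) (∈-allSubsets S))
∈-allSubsets {suc n} (inside ∷ S) = ∈-++⁺ʳ (map (outside ∷_) (allSubsets n)) (∈-map⁺ (inside ∷_) (∈-allSubsets S))

allᵇ⁺ : ∀ {A : Set} {p : A → Bool} (xs : List A) → (∀ x → p x ≡ true) → allᵇ p xs ≡ true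
allᵇ⁺ [] _ = refl
allᵇ⁺ {p = p} (x ∷ xs) all rewrite all x = allᵇ⁺ xs all

allᵇ⁻ : ∀ {A : Set} {p : A → Bool} {xs : List A} → allᵇ p xs ≡ true → ∀ {x} → x ∈ₗ xs → p x ≡ true
allᵇ⁻ {p = p} {x ∷ xs} e (here refl) with p x
... | true = refl
allᵇ⁻ {p = p} {x ∷ xs} e (there x∈xs) with p x
... | true = allᵇ⁻ e x∈xs

independentᵇ⁺ : ∀ (G : Graph n) S → Independent G S → independentᵇ G S ≡ true
independentᵇ⁺ {n} G S ind = allᵇ⁺ (allFin n) λ i → allᵇ⁺ (allFin n) λ j → entry i j
  where
  entry : ∀ i j → not (memᵇ i S ∧ memᵇ j S ∧ adj G i j) ≡ true
  entry i j with lookup S i in i∈S | lookup S j in j∈S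
  ... | false | _ = refl
  ... | true | false = refl
  ... | true | true = cong not (ind i j (lookup⇒[]= i S i∈S) (lookup⇒[]= j S j∈S))

independentᵇ⁻ : ∀ (G : Graph n) S → independentᵇ G S ≡ true → Independent G S
independentᵇ⁻ G S e i j i∈S j∈S = Bool.not-injective (trans
  (cong not (≡-sym (cong₂ (λ a b → a ∧ b ∧ adj G i j) ([]=⇒lookup i∈S) ([]=⇒lookup j∈S))))
  (allᵇ⁻ (allᵇ⁻ e (∈-allFin i)) (∈-allFin j)))

-- The disjunction local to maximalIndependentᵇ has no name in scope; unification supplies the predicate.
undominatedᵇ : ∀ (G : Graph n) S → Σ (Fin n → Bool) λ p →
  maximalIndependentᵇ G S ≡ independentᵇ G S ∧ allᵇ p (allFin n)
undominatedᵇ G S = _ , refl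

maximalIndependentᵇ⁺ : ∀ (G : Graph n) I → MaximalIn G ⊤ I → maximalIndependentᵇ G I ≡ true
maximalIndependentᵇ⁺ {n} G I (_ , ind , dom) rewrite independentᵇ⁺ G I ind = allᵇ⁺ (allFin n) entry
  where
  extension-dependent : ∀ v → v ∉ I → independentᵇ G (I ∪ ⁅ v ⁆) ≡ false
  extension-dependent v v∉I with dom v ∈⊤ v∉I
  ... | x , x∈I , x~v = Bool.¬-not λ e → true≢false x~v
    (independentᵇ⁻ G _ e x v (p⊆p∪q ⁅ v ⁆ x∈I) (q⊆p∪q I ⁅ v ⁆ (x∈⁅x⁆ v)))
  entry : ∀ v → proj₁ (undominatedᵇ G I) v ≡ true
  entry v with lookup I v in v∈I
  ... | true = refl
  ... | false = cong not (extension-dependent v (lookup⇒∉ v∈I))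

foldr-⊓-≤ : ∀ {A : Set} (size : A → ℕ) (p : A → Bool) {m : ℕ} {xs : List A} {x} → x ∈ₗ xs → p x ≡ true →
  foldr (λ y → size y ⊓_) m (filterᵇ p xs) ≤ size x
foldr-⊓-≤ size p {xs = x ∷ xs} (here refl) px rewrite px = m⊓n≤m _ _
foldr-⊓-≤ size p {xs = y ∷ xs} (there x∈xs) px with p y
... | true = ≤-trans (m⊓n≤n (size y) _) (foldr-⊓-≤ size p x∈xs px)
... | false = foldr-⊓-≤ size p x∈xs px

μ≤ : ∀ (G : Graph n) I → MaximalIn G ⊤ I → μ G ≤ ∣ I ∣
μ≤ G I max = foldr-⊓-≤ ∣_∣ (maximalIndependentᵇ G) (∈-allSubsets I) (maximalIndependentᵇ⁺ G I max)

-- The test is a parameter known only through its equations, so that the local test of `sizeIsᵇ` can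
-- be supplied for it.
eqTest-complete : ∀ (e : ℕ → ℕ → Bool) → e 0 0 ≡ true → (∀ a b → e (suc a) (suc b) ≡ e a b) →
  ∀ a b → a ≡ b → e a b ≡ true
eqTest-complete e e-zero e-suc zero _ refl = e-zero
eqTest-complete e e-zero e-suc (suc a) _ refl = trans (e-suc a a) (eqTest-complete e e-zero e-suc a a refl)

-- The equality test local to sizeIsᵇ has no name in scope, so it is left to unification.
mutual
  sizeTest : ∀ n → ℕ → Subset n → ℕ → ℕ → Bool
  sizeTest = _

  sizeIsᵇ⁺ : ∀ r (S : Subset n) → ∣ S ∣ ≡ r → sizeIsᵇ r S ≡ true
  sizeIsᵇ⁺ zero S e with ∣ S ∣
  sizeIsᵇ⁺ zero S refl | zero = refl
  sizeIsᵇ⁺ (suc r) S e with ∣ S ∣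
  -- `suc r` also occurs as a parameter of the local test. Abstracting it to `k` leaves distinct
  -- variables as arguments, from which unification can solve `sizeTest`.
  ... | suc s with suc-injective e | suc r
  ...   | s≡r | k = eqTest-complete (sizeTest _ k S) refl (λ _ _ → refl) s r s≡r

length-filterᵇ-map : ∀ {A B : Set} (p : B → Bool) (f : A → B) xs →
  length (filterᵇ p (map f xs)) ≡ length (filterᵇ (p ∘ f) xs)
length-filterᵇ-map p f [] = refl
length-filterᵇ-map p f (x ∷ xs) with p (f x)
... | true = cong suc (length-filterᵇ-map p f xs)
... | false = length-filterᵇ-map p f xs

#≡length : ∀ (p : Subset n → Bool) → # p ≡ length (filterᵇ p (allSubsets n))
#≡length {zero} p rewrite ∑-[] (χ ∘ p) with p []
... | true = refl
... | false = refl
#≡length {suc n} p = begin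
  # p ≡⟨ ∑-∷ _ ⟩
  # (p ∘ (outside ∷_)) + # (p ∘ (inside ∷_)) ≡⟨ cong₂ _+_ (half outside) (half inside) ⟩
  length (filterᵇ p (map (outside ∷_) (allSubsets n))) + length (filterᵇ p (map (inside ∷_) (allSubsets n)))
    ≡⟨ length-++ (filterᵇ p (map (outside ∷_) (allSubsets n))) ⟨
  length (filterᵇ p (map (outside ∷_) (allSubsets n)) ++ filterᵇ p (map (inside ∷_) (allSubsets n)))
    ≡⟨ cong length (filter-++ _ (map (outside ∷_) (allSubsets n)) _) ⟨
  length (filterᵇ p (allSubsets (suc n))) ∎
  where
  open ≡-Reasoning
  half : ∀ x → # (p ∘ (x ∷_)) ≡ length (filterᵇ p (map (x ∷_) (allSubsets n)))
  half x = trans (#≡length (p ∘ (x ∷_))) (≡-sym (length-filterᵇ-map p (x ∷_) (allSubsets n)))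

#independent≤length-J : ∀ (G : Graph n) r → # (does ∘ independentIn? G ⊤ r) ≤ length (J G r)
#independent≤length-J G r = ≤-trans
  (∑-mono λ S → χ-mono λ e → let _ , ind , size = dec-sound (independentIn? G ⊤ r S) e in
    cong₂ _∧_ (independentᵇ⁺ G S ind) (sizeIsᵇ⁺ r S size))
  (≤-reflexive (#≡length _))

_≟ₛ_ : ∀ (S T : Subset n) → Dec (S ≡ T)
_≟ₛ_ = ≡-dec Bool._≟_

_∈ₗ?_ : ∀ (S : Subset n) 𝒜 → Dec (S ∈ₗ 𝒜)
_∈ₗ?_ = ∈ₗ-dec _≟ₛ_

#-singleton : ∀ (A : Subset n) → # (does ∘ (_≟ₛ A)) ≡ 1
#-singleton [] = ∑-[] _
#-singleton (outside ∷ A) = trans (∑-∷ _) (cong₂ _+_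
  (trans (#-⇔ (_≟ₛ (outside ∷ A) ∘ (outside ∷_)) (_≟ₛ A) λ S → mk⇔ ∷-injectiveʳ (cong (outside ∷_))) (#-singleton A))
  (#-empty (_≟ₛ (outside ∷ A) ∘ (inside ∷_)) λ S → λ ()))
#-singleton (inside ∷ A) = trans (∑-∷ _) (cong₂ _+_
  (#-empty (_≟ₛ (inside ∷ A) ∘ (outside ∷_)) λ S → λ ())
  (trans (#-⇔ (_≟ₛ (inside ∷ A) ∘ (inside ∷_)) (_≟ₛ A) λ S → mk⇔ ∷-injectiveʳ (cong (inside ∷_))) (#-singleton A)))

-- Uniqueness keeps the head out of the tail, so the two indicators are never 1 at the same set.
length≤#∈ : ∀ {𝒜 : List (Subset n)} → Unique 𝒜 → length 𝒜 ≤ # (λ S → does (S ∈ₗ? 𝒜))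
length≤#∈ [] = z≤n
length≤#∈ {𝒜 = A ∷ 𝒜} (A∉𝒜 ∷ unique) = begin
  1 + length 𝒜 ≤⟨ +-mono-≤ (≤-reflexive (≡-sym (#-singleton A))) (length≤#∈ unique) ⟩
  # (does ∘ (_≟ₛ A)) + # (λ S → does (S ∈ₗ? 𝒜)) ≡⟨ ∑-+ _ _ ⟨
  ∑ (λ S → χ (does (S ≟ₛ A)) + χ (does (S ∈ₗ? 𝒜))) ≤⟨ ∑-mono pointwise ⟩
  # (λ S → does (S ∈ₗ? (A ∷ 𝒜))) ∎
  where
  open ≤-Reasoning
  pointwise : ∀ S → χ (does (S ≟ₛ A)) + χ (does (S ∈ₗ? 𝒜)) ≤ χ (does (S ∈ₗ? (A ∷ 𝒜)))
  pointwise S = split (S ≟ₛ A) (S ∈ₗ? 𝒜) (S ∈ₗ? (A ∷ 𝒜))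
    where
    split : (a? : Dec (S ≡ A)) (m? : Dec (S ∈ₗ 𝒜)) (am? : Dec (S ∈ₗ (A ∷ 𝒜))) →
      χ (does a?) + χ (does m?) ≤ χ (does am?)
    split (yes refl) (yes m) _ = contradiction refl (All-lookup A∉𝒜 m)
    split (yes e) (no _) am? = ≤-reflexive (cong χ (≡-sym (dec-true am? (here e))))
    split (no _) (yes m) am? = ≤-reflexive (cong χ (≡-sym (dec-true am? (there m))))
    split (no _) (no _) _ = z≤n

theorem1p7 : ∀ {n} (G : Graph n) → Chordal G → (r : ℕ) → 1 ≤ r → 2 * r ≤ μ G →
    (𝒜 ℬ : List (Subset n)) → Unique 𝒜 → Unique ℬ → CrossIntersecting G r 𝒜 ℬ →
    length 𝒜 + length ℬ ≤ length (J G r)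
theorem1p7 {n} G chordal r _ 2r≤μ 𝒜 ℬ unique𝒜 uniqueℬ (𝒜⊆J , ℬ⊆J , cross) = begin
  length 𝒜 + length ℬ ≤⟨ +-mono-≤ (length≤#∈ unique𝒜) (length≤#∈ uniqueℬ) ⟩
  -- The induction starts at `W = ⊤`, where `μ G` bounds the size of every maximal independent set
  -- from below.
  # (member 𝒜) + # (member ℬ) ≤⟨ bound G chordal (suc ∣ ⊤ {n} ∣) ⊤ ≤-refl r
    (λ I max → ≤-trans 2r≤μ (μ≤ G I max)) (member-⊑ 𝒜⊆J) (member-⊑ ℬ⊆J)
    (λ S T S∈ T∈ → cross S T (dec-sound (S ∈ₗ? 𝒜) S∈) (dec-sound (T ∈ₗ? ℬ) T∈)) ⟩
  # (does ∘ independentIn? G ⊤ r) ≤⟨ #independent≤length-J G r ⟩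
  length (J G r) ∎
  where
  open ≤-Reasoning
  member : List (Subset n) → Family n
  member 𝒞 S = does (S ∈ₗ? 𝒞)
  member-⊑ : ∀ {𝒞} → All (InJ G r) 𝒞 → member 𝒞 ⊑ IndependentIn G ⊤ r
  member-⊑ {𝒞} 𝒞⊆J S S∈ = (λ _ → ∈⊤) , All-lookup 𝒞⊆J (dec-sound (S ∈ₗ? 𝒞) S∈)
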